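{- For all $n \in \mathbb{Z}^+$ and for all $s \in \mathbb{Z}^+$ with $1 \leq s \leq n-1$, there is an $s$-overlap cycle for $\mathcal{W}(n)$.
   Context: $\mathcal{W}(n)$ denotes the set of weak orders on $[n]$ (transitive and complete relations), represented as words: $\mathcal{W}(n)$ is the set of all words $w_1w_2\ldots w_n$ of length $n$ over the nonnegative integers such that $\{w_1,\dots,w_n\} = \{0,1,\dots,h\}$ for some $h$ with $0 \le h \le n-1$ (here $w_j$ is the height of element $j$ in the weak order). An $s$-overlap cycle ($s$-ocycle) for a set of words of length $n$ is a cyclically ordered listing of the words in the set, each appearing exactly once, such that the last $s$ letters of each word are the first $s$ letters (in the same order) of its successor in the listing (the successor of the last word being the first word). -}

module Defs where

open import Data.Nat.Base using (ℕ; _∸_; _≤_)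
open import Data.List.Base using (List; []; _∷_; _∷ʳ_; length; take; drop)
open import Data.List.Membership.Propositional using (_∈_)
open import Data.List.Relation.Unary.Linked using (Linked)
open import Data.List.Relation.Unary.Unique.Propositional using (Unique)
open import Data.Product.Base using (_×_; ∃-syntax)
open import Data.Unit.Base using (⊤)
open import Function.Bundles using (_⇔_)
open import Relation.Binary.Core using (Rel)
open import Relation.Binary.PropositionalEquality.Core using (_≡_)
open import Relation.Unary using (Pred)
open import Level using (0ℓ)

-- The j-th letter is the height of element j in the weak order; the last
-- component says that the set of letters is exactly {0, 1, …, h}.
𝓦 : ℕ → Pred (List ℕ) 0ℓ
𝓦 n w = length w ≡ n × ∃[ h ] (h ≤ n ∸ 1 × (∀ k → k ∈ w ⇔ k ≤ h))

-- Meaningful only for words of length at least s, since take and drop truncate.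
Overlap : {A : Set} → ℕ → Rel (List A) 0ℓ
Overlap s u v = drop (length u ∸ s) u ≡ take s v

-- Repeating the first entry at the end accounts for the wrap-around step
-- from the last entry to the first.
CyclicallyLinked : {A : Set} → Rel A 0ℓ → Pred (List A) 0ℓ
CyclicallyLinked R []       = ⊤
CyclicallyLinked R (x ∷ xs) = Linked R ((x ∷ xs) ∷ʳ x)

record IsOverlapCycle {A : Set} (s : ℕ) (S : Pred (List A) 0ℓ)
                      (ws : List (List A)) : Set where
  field
    unique : Unique ws
    lists  : ∀ w → w ∈ ws ⇔ S w
    cyclic : CyclicallyLinked (Overlap s) ws

{-# OPTIONS --safe #-}

-- Rotating a word left by s gives a predecessor of it for the s-overlap
-- relation, so the orbits of this rotation are cycles covering 𝓦 n. Two cycles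
-- through distinct words with the same s-prefix can be spliced into one, since
-- such words have the same predecessors. Splicing reaches all of 𝓦 n from the
-- fixed point 0…0: rotate a nonzero word until an occurrence of its largest
-- letter lies outside the s-prefix, and replace that occurrence by 0; this stays
-- in 𝓦 n, keeps the s-prefix and decreases the sum of the letters.
module Submission where

open import Defs
open import Data.List.Base
  using (List; []; _∷_; _++_; _∷ʳ_; [_]; length; take; drop; replicate; upTo; cartesianProductWith)
open import Data.List.Membership.Propositional using (_∈_; _∉_)
open import Data.List.Membership.Propositional.Properties
  using (∈-∃++; ∈-cartesianProductWith⁺; ∈-upTo⁺; ∈-upTo⁻)
open import Data.List.Properties
  using (∷ʳ-injective; ++-assoc; ++-identityʳ; length-++; length-replicate;
         length-take; take++drop≡id; ≡-dec)
open import Data.List.Relation.Binary.Permutation.Propositional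
  using (_↭_; ↭-refl; ↭-reflexive; ↭-sym; ↭-trans; ↭⇒↭ₛ)
open import Data.List.Relation.Binary.Permutation.Propositional.Properties
  using (∈-resp-↭; All-resp-↭; ↭-length; shift; ∷↭∷ʳ)
import Data.List.Relation.Binary.Permutation.Setoid.Properties as Permutationₛ
open import Data.List.Relation.Binary.Subset.Propositional using (_⊆_)
open import Data.List.Relation.Unary.All as All using (All; []; _∷_)
open import Data.List.Relation.Unary.All.Properties using (¬Any⇒All¬; All¬⇒¬Any; replicate⁺)
open import Data.List.Relation.Unary.AllPairs using ([]; _∷_)
open import Data.List.Relation.Unary.Any using (here; there)
open import Data.List.Relation.Unary.Linked using (Linked; [-]; _∷_)
open import Data.List.Relation.Unary.Unique.Propositional using (Unique)
open import Data.Nat.Base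
  using (ℕ; zero; suc; _+_; _*_; _∸_; _≤_; _<_; z≤n; s≤s; s≤s⁻¹)
open import Data.Nat.GeneralisedArithmetic using (iterate)
open import Data.Nat.Induction using (<-wellFounded)
open import Data.Nat.ListAction using (sum)
open import Data.Nat.ListAction.Properties using (sum-↭)
open import Data.Nat.Properties
  using (_≟_; _≤?_; ≤-refl; ≤-reflexive; ≤-trans; ≤∧≢⇒<; ≰⇒>; <⇒≤; n≤0⇒n≡0; m≤n⇒m≤1+n;
         +-suc; *-comm; m≤n+m; +-monoʳ-≤; +-cancelˡ-<; m≤n⇒m⊓n≡m;
         m≤m+n; m+n∸n≡m; 1+n≰n; m≤n⇒∃[o]m+o≡n; anyUpTo?; module ≤-Reasoning)
open import Data.Product.Base using (∃-syntax; _×_; _,_)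
open import Data.Sum.Base using (_⊎_; inj₁; inj₂; [_,_]′)
open import Function.Base using (_∘_; id)
open import Function.Bundles using (_⇔_; mk⇔; Equivalence)
open import Function.Definitions using (Injective)
open import Induction.WellFounded using (Acc; acc)
open import Level using (0ℓ)
open import Relation.Binary.Core using (Rel)
open import Relation.Binary.Definitions using (DecidableEquality)
open import Relation.Binary.PropositionalEquality
  using (_≡_; refl; sym; trans; cong; subst; setoid; module ≡-Reasoning)
open import Relation.Nullary using (yes; no; contradiction)
open import Relation.Nullary.Decidable using (map′; _×-dec_)
open import Relation.Unary using (Pred; Decidable)

open Equivalence using (to; from)

private
  variable
    A : Set
    R : Rel A 0ℓ

-- Rotations

rotate₁ : List A → List A
rotate₁ []       = []
rotate₁ (x ∷ xs) = xs ∷ʳ x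

rotate : ℕ → List A → List A
rotate k xs = iterate rotate₁ xs k

rotate-++ : (xs ys : List A) → rotate (length xs) (xs ++ ys) ≡ ys ++ xs
rotate-++ []       ys = sym (++-identityʳ ys)
rotate-++ (x ∷ xs) ys = begin
  rotate (length xs) ((xs ++ ys) ∷ʳ x)  ≡⟨ cong (rotate (length xs)) (++-assoc xs ys [ x ]) ⟩
  rotate (length xs) (xs ++ ys ∷ʳ x)    ≡⟨ rotate-++ xs (ys ∷ʳ x) ⟩
  (ys ∷ʳ x) ++ xs                       ≡⟨ ++-assoc ys [ x ] xs ⟩
  ys ++ x ∷ xs                          ∎
  where open ≡-Reasoning

rotate₁-↭ : (xs : List A) → rotate₁ xs ↭ xs
rotate₁-↭ []       = ↭-refl
rotate₁-↭ (x ∷ xs) = ↭-sym (∷↭∷ʳ x xs)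

rotate-↭ : ∀ k (xs : List A) → rotate k xs ↭ xs
rotate-↭ zero    xs = ↭-refl
rotate-↭ (suc k) xs = ↭-trans (rotate-↭ k (rotate₁ xs)) (rotate₁-↭ xs)

rotate₁-injective : Injective _≡_ _≡_ (rotate₁ {A})
rotate₁-injective {x = []}     {[]}     eq = refl
rotate₁-injective {x = []}     {y ∷ ys} eq
  with () ← trans (cong length eq) (↭-length (rotate₁-↭ (y ∷ ys)))
rotate₁-injective {x = x ∷ xs} {[]}     eq
  with () ← trans (sym (cong length eq)) (↭-length (rotate₁-↭ (x ∷ xs)))
rotate₁-injective {x = x ∷ xs} {y ∷ ys} eq with refl , refl ← ∷ʳ-injective xs ys eq = refl

rotate-injective : ∀ k → Injective _≡_ _≡_ (rotate {A} k)
rotate-injective zero    eq = eq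
rotate-injective (suc k) eq = rotate₁-injective (rotate-injective k eq)

iterate-+ : (f : A → A) (x : A) (m n : ℕ) → iterate f x (m + n) ≡ iterate f (iterate f x m) n
iterate-+ f x zero    n = refl
iterate-+ f x (suc m) n = iterate-+ f (f x) m n

iterate-* : (f : A → A) (k : ℕ) (x : A) (m : ℕ) →
            iterate (λ y → iterate f y k) x m ≡ iterate f x (m * k)
iterate-* f k x zero    = refl
iterate-* f k x (suc m) = trans (iterate-* f k _ m) (sym (iterate-+ f x k (m * k)))

iterate-fixed : {f : A → A} {x : A} → f x ≡ x → ∀ m → iterate f x m ≡ x
iterate-fixed fx≡x zero    = refl
iterate-fixed fx≡x (suc m) rewrite fx≡x = iterate-fixed fx≡x m

-- `length xs` turns by `k` places amount to `k` turns by `length xs` places, each of which is the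
-- identity.
iterate-rotate : ∀ k (xs : List A) → iterate (rotate k) xs (length xs) ≡ xs
iterate-rotate k xs = begin
  iterate (rotate k) xs (length xs)  ≡⟨ iterate-* rotate₁ k xs (length xs) ⟩
  rotate (length xs * k) xs          ≡⟨ cong (λ m → rotate m xs) (*-comm (length xs) k) ⟩
  rotate (k * length xs) xs          ≡⟨ iterate-* rotate₁ (length xs) xs k ⟨
  iterate (rotate (length xs)) xs k  ≡⟨ iterate-fixed fixed k ⟩
  xs                                 ∎
  where
  open ≡-Reasoning
  fixed : rotate (length xs) xs ≡ xs
  fixed = trans (cong (rotate (length xs)) (sym (++-identityʳ xs))) (rotate-++ xs [])

-- The count starts at `rotate k xs` because splicing enters an orbit at the image of the missing
-- word and stops at that word itself.
rotate-periodic : ∀ k (xs : List A) → ∃[ j ] iterate (rotate k) (rotate k xs) j ≡ xs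
rotate-periodic k []         = 0 , iterate-fixed refl k
rotate-periodic k xs@(_ ∷ ys) = length ys , iterate-rotate k xs

split-at : ∀ k (xs : List A) → k < length xs →
           ∃[ ys ] ∃[ z ] ∃[ zs ] xs ≡ ys ++ z ∷ zs × length ys ≡ k
split-at zero    (x ∷ xs) _   = [] , x , xs , refl , refl
split-at (suc k) (x ∷ xs) k<l
  with ys , z , zs , refl , refl ← split-at k xs (s≤s⁻¹ k<l) = x ∷ ys , z , zs , refl , refl

take-++-≤ : ∀ k (xs ys zs : List A) → k ≤ length xs → take k (xs ++ ys) ≡ take k (xs ++ zs)
take-++-≤ zero    xs       ys zs _   = refl
take-++-≤ (suc k) (x ∷ xs) ys zs k≤l = cong (x ∷_) (take-++-≤ k xs ys zs (s≤s⁻¹ k≤l))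

take-length-++ : (xs ys : List A) → take (length xs) (xs ++ ys) ≡ xs
take-length-++ []       ys = refl
take-length-++ (x ∷ xs) ys = cong (x ∷_) (take-length-++ xs ys)

drop-length-++ : (xs ys : List A) → drop (length xs) (xs ++ ys) ≡ ys
drop-length-++ []       ys = refl
drop-length-++ (x ∷ xs) ys = drop-length-++ xs ys

-- While fewer than `s` letters precede `x`, rotating by `s` moves the nonempty rest of the word in
-- front of `p`, so the position of `x` grows until it is at least `s`. `unrotate` then carries `Q`
-- back along these rotations.
rotate-past-prefix : (Q : Pred (List A) 0ℓ) {s n : ℕ} → s < n →
  (∀ {w} → Q (rotate s w) → Q w) →
  ∀ x p q → length (p ++ x ∷ q) ≡ n →
  (∀ p′ q′ → p′ ++ x ∷ q′ ↭ p ++ x ∷ q → s ≤ length p′ → Q (p′ ++ x ∷ q′)) →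
  Q (p ++ x ∷ q)
rotate-past-prefix Q {s} {n} s<n unrotate x p₀ q₀ len base =
  -- The first argument of `go` bounds how many letters the part before `x` still lacks to have
  -- length `s`.
  go s p₀ q₀ ↭-refl (m≤m+n s (length p₀))
  where
  go : ∀ d p q → p ++ x ∷ q ↭ p₀ ++ x ∷ q₀ → s ≤ d + length p → Q (p ++ x ∷ q)
  go zero    p q perm s≤ = base p q perm s≤
  go (suc d) p q perm s≤ with s ≤? length p
  ... | yes s≤p = base p q perm s≤p
  ... | no  s≰p
    -- The `r` letters after `x` complete the `s`-prefix, and `s < n` leaves a letter `y` beyond it.
    with r , refl ← m≤n⇒∃[o]m+o≡n (≰⇒> s≰p)
    with q₁ , y , q₂ , refl , refl ← split-at r q
           (+-cancelˡ-< (suc (length p)) r (length q)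
             (subst (suc (length p) + r <_)
               (trans (sym (trans (↭-length perm) len)) (trans (length-++ p) (+-suc (length p) _))) s<n))
    = unrotate (subst Q (sym rotated) (go d (y ∷ q₂ ++ p) q₁
        (↭-trans (↭-reflexive (sym rotated)) (↭-trans (rotate-↭ s _) perm))
        (≤-trans s≤ longer)))
    where
    longer : suc d + length p ≤ d + length (y ∷ q₂ ++ p)
    longer = begin
      suc (d + length p)                ≡⟨ +-suc d (length p) ⟨
      d + suc (length p)                ≤⟨ +-monoʳ-≤ d (s≤s (m≤n+m (length p) (length q₂))) ⟩
      d + suc (length q₂ + length p)    ≡⟨ cong (λ m → d + suc m) (length-++ q₂) ⟨
      d + length (y ∷ q₂ ++ p)          ∎
      where open ≤-Reasoning
    prefix = p ++ x ∷ q₁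
    suffix = y ∷ q₂
    length-prefix : length prefix ≡ s
    length-prefix = trans (length-++ p) (+-suc (length p) (length q₁))
    rotated : rotate s (p ++ x ∷ q₁ ++ suffix) ≡ (suffix ++ p) ++ x ∷ q₁
    rotated = begin
      rotate s (p ++ x ∷ q₁ ++ suffix)            ≡⟨ cong (rotate s) (++-assoc p (x ∷ q₁) suffix) ⟨
      rotate s (prefix ++ suffix)                 ≡⟨ cong (λ m → rotate m (prefix ++ suffix)) length-prefix ⟨
      rotate (length prefix) (prefix ++ suffix)   ≡⟨ rotate-++ prefix suffix ⟩
      suffix ++ prefix                            ≡⟨ ++-assoc suffix p (x ∷ q₁) ⟨
      (suffix ++ p) ++ x ∷ q₁                     ∎
      where open ≡-Reasoning

-- Splicing cycles

linked-∷ʳ : ∀ xs {y z : A} → Linked R (xs ∷ʳ y) → R y z → Linked R ((xs ∷ʳ y) ∷ʳ z)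
linked-∷ʳ []           [-]        Ryz = Ryz ∷ [-]
linked-∷ʳ (x ∷ [])     (Rxy ∷ l)  Ryz = Rxy ∷ linked-∷ʳ [] l Ryz
linked-∷ʳ (x ∷ w ∷ xs) (Rxw ∷ l)  Ryz = Rxw ∷ linked-∷ʳ (w ∷ xs) l Ryz

linked-replace-last : ∀ xs {y z : A} → (∀ {w} → R w y → R w z) →
                      Linked R (xs ∷ʳ y) → Linked R (xs ∷ʳ z)
linked-replace-last []           f [-]       = [-]
linked-replace-last (x ∷ [])     f (Rxy ∷ _) = f Rxy ∷ [-]
linked-replace-last (x ∷ w ∷ xs) f (Rxw ∷ l) = Rxw ∷ linked-replace-last (w ∷ xs) f l

cyclicallyLinked-rotate₁ : (xs : List A) → CyclicallyLinked R xs → CyclicallyLinked R (rotate₁ xs)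
cyclicallyLinked-rotate₁ []           l         = l
cyclicallyLinked-rotate₁ (x ∷ [])     l         = l
cyclicallyLinked-rotate₁ (x ∷ y ∷ xs) (Rxy ∷ l) = linked-∷ʳ (y ∷ xs) l Rxy

cyclicallyLinked-rotate : ∀ k (xs : List A) → CyclicallyLinked R xs → CyclicallyLinked R (rotate k xs)
cyclicallyLinked-rotate zero    xs l = l
cyclicallyLinked-rotate (suc k) xs l =
  cyclicallyLinked-rotate k (rotate₁ xs) (cyclicallyLinked-rotate₁ xs l)

module Splicing
  (_≟ᴬ_ : DecidableEquality A) (S : Pred A 0ℓ) (R : Rel A 0ℓ) (τ : A → A)
  (τ-injective : Injective _≡_ _≡_ τ)
  (τ-periodic : ∀ x → ∃[ j ] iterate τ (τ x) j ≡ x)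
  (τ-closed : ∀ {x} → S x → S (τ x))
  (τ-linked : ∀ {x} → S x → R (τ x) x)
  (root : A)
  where

  open import Data.List.Membership.DecPropositional _≟ᴬ_ using (_∈?_)

  -- By periodicity of `τ`, closure under preimages makes the entries a union of whole orbits. Their
  -- cyclic order need only respect `R`.
  record PartialCycle (xs : List A) : Set where
    field
      rooted : root ∈ xs
      unique : Unique xs
      sound  : All S xs
      closed : ∀ {z} → τ z ∈ xs → z ∈ xs
      cyclic : CyclicallyLinked R xs

  Extension : Pred A 0ℓ → Pred (List A) 0ℓ
  Extension P xs = ∃[ ys ] PartialCycle ys × xs ⊆ ys × (∀ {z} → P z → z ∈ ys)

  -- Quantifying over all partial cycles lets elements be adjoined one after another without losing
  -- earlier ones.
  Reachable : Pred A 0ℓ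
  Reachable x = ∀ {xs} → PartialCycle xs → Extension (x ≡_) xs

  singleton : S root → τ root ≡ root → PartialCycle [ root ]
  singleton Sroot fixed = record
    { rooted = here refl
    ; unique = [] ∷ []
    ; sound  = Sroot ∷ []
    ; closed = λ { (here eq) → here (τ-injective (trans eq (sym fixed))) }
    ; cyclic = subst (λ z → R z root) fixed (τ-linked Sroot) ∷ [-]
    }

  reach-root : Reachable root
  reach-root {xs} C = xs , C , id , λ { refl → PartialCycle.rooted C }

  reach-τ : ∀ {x} → Reachable (τ x) → Reachable x
  reach-τ reach C with ys , D , xs⊆ys , τx∈ys ← reach C =
    ys , D , xs⊆ys , λ { refl → PartialCycle.closed D (τx∈ys refl) }

  rotate-to : ∀ {x xs} → PartialCycle xs → x ∈ xs →
              ∃[ zs ] PartialCycle (x ∷ zs) × xs ⊆ x ∷ zs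
  rotate-to {x} C x∈xs with ys , zs , refl ← ∈-∃++ x∈xs =
    zs ++ ys , subst PartialCycle (rotate-++ ys (x ∷ zs)) rotated
             , subst (ys ++ x ∷ zs ⊆_) (rotate-++ ys (x ∷ zs)) (∈-resp-↭ (↭-sym perm))
    where
    open PartialCycle C
    perm = rotate-↭ (length ys) (ys ++ x ∷ zs)
    rotated : PartialCycle (rotate (length ys) (ys ++ x ∷ zs))
    rotated = record
      { rooted = ∈-resp-↭ (↭-sym perm) rooted
      ; unique = Permutationₛ.Unique-resp-↭ (setoid A) (↭⇒↭ₛ (↭-sym perm)) unique
      ; sound  = All-resp-↭ (↭-sym perm) sound
      ; closed = ∈-resp-↭ (↭-sym perm) ∘ closed ∘ ∈-resp-↭ perm
      ; cyclic = cyclicallyLinked-rotate (length ys) _ cyclic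
      }

  -- By injectivity, τ y can only repeat an earlier entry when y ≡ x, and then the
  -- orbit of x has been completed.
  close : ∀ {x} j y zs → iterate τ y j ≡ x → root ∈ zs → Unique (y ∷ zs) → All S (y ∷ zs) →
          (∀ {z} → τ z ∈ y ∷ zs → z ≡ x ⊎ z ∈ zs) →
          Linked R ((y ∷ zs) ∷ʳ x) → Extension (x ≡_) zs
  close {x} j y zs orbit r u S∷ closed l with y ≟ᴬ x
  ... | yes refl = y ∷ zs , C , there , λ { refl → here refl }
    where
    C : PartialCycle (y ∷ zs)
    C = record { rooted = there r ; unique = u ; sound = S∷ ; cyclic = l
               ; closed = λ τz∈ → [ here , there ]′ (closed τz∈) }
  close zero    y zs orbit r u S∷ closed l | no y≢x = contradiction orbit y≢x
  close {x} (suc j) y zs orbit r u@(y# ∷ _) (Sy ∷ Szs) closed l | no y≢x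
    = let ws , C , ⊆ws , x∈ = close j (τ y) (y ∷ zs) orbit (there r)
            (¬Any⇒All¬ _ fresh ∷ u) (τ-closed Sy ∷ Sy ∷ Szs) closed′ (τ-linked Sy ∷ l)
      in ws , C , ⊆ws ∘ there , x∈
    where
    fresh : τ y ∉ y ∷ zs
    fresh τy∈ = [ y≢x , All¬⇒¬Any y# ]′ (closed τy∈)
    closed′ : ∀ {z} → τ z ∈ τ y ∷ y ∷ zs → z ≡ x ⊎ z ∈ y ∷ zs
    closed′ (here eq)   = inj₂ (here (τ-injective eq))
    closed′ (there τz∈) = [ inj₁ , inj₂ ∘ there ]′ (closed τz∈)

  -- The link into `x′` is redirected to `x`. The orbit of `x`, traversed against `τ`, then leads
  -- from `x` to `τ x`, which links to `x′` as it does to `x`.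
  reach-twin : ∀ {x x′} → S x → (∀ {z} → R z x → R z x′) → (∀ {z} → R z x′ → R z x) →
               Reachable x′ → Reachable x
  reach-twin {x} {x′} Sx x⇒x′ x′⇒x reach C
    with ys , D , xs⊆ys , x′∈ys ← reach C
    -- With `x′` at the head, the link to be redirected is the closing one.
    with zs , E , ys⊆ ← rotate-to D (x′∈ys refl)
    with x ∈? (x′ ∷ zs)
  ... | yes x∈ = x′ ∷ zs , E , ys⊆ ∘ xs⊆ys , λ { refl → x∈ }
  ... | no  x∉
    = let j , orbit = τ-periodic x
          ws , F , ⊆ws , x∈ws = close j (τ x) (x′ ∷ zs) orbit
            rooted (¬Any⇒All¬ _ (x∉ ∘ closed) ∷ unique) (τ-closed Sx ∷ sound)
            -- The old cycle is closed under preimages, so the new head `τ x` is the only entry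
            -- whose preimage, `x`, is still missing.
            (λ { (here eq) → inj₁ (τ-injective eq) ; (there τz∈) → inj₂ (closed τz∈) })
            (x⇒x′ (τ-linked Sx) ∷ linked-replace-last (x′ ∷ zs) x′⇒x cyclic)
      in ws , F , ⊆ws ∘ ys⊆ ∘ xs⊆ys , x∈ws
    where open PartialCycle E

  -- The list `vs` may contain elements outside `S`; deciding `S` tells which ones to adjoin.
  exhaust : Decidable S → (∀ {x} → S x → Reachable x) →
            ∀ vs {xs} → PartialCycle xs → Extension (λ z → S z × z ∈ vs) xs
  exhaust S? reach []       {xs} C = xs , C , id , λ ()
  exhaust S? reach (v ∷ vs) C
    with exhaust S? reach vs C | S? v
  ... | ys , D , xs⊆ys , vs∈ | no ¬Sv = ys , D , xs⊆ys ,
    λ { (Sz , here refl) → contradiction Sz ¬Sv ; (Sz , there z∈) → vs∈ (Sz , z∈) }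
  ... | ys , D , xs⊆ys , vs∈ | yes Sv
    with ws , E , ys⊆ws , v∈ ← reach Sv D = ws , E , ys⊆ws ∘ xs⊆ys ,
    λ { (_ , here refl) → v∈ refl ; (Sz , there z∈) → ys⊆ws (vs∈ (Sz , z∈)) }

-- Weak orders as words

open import Data.List.Membership.DecPropositional _≟_ using (_∈?_)

𝓦-resp-↭ : ∀ {n v w} → v ↭ w → 𝓦 n v → 𝓦 n w
𝓦-resp-↭ v↭w (len , h , h≤ , letters) = trans (↭-length (↭-sym v↭w)) len , h , h≤ ,
  λ k → mk⇔ (to (letters k) ∘ ∈-resp-↭ (↭-sym v↭w)) (∈-resp-↭ v↭w ∘ from (letters k))

-- For a given `h`, the equivalence over all `k` reduces to two finite checks: no letter exceeds
-- `h`, and each of 0, ..., `h` occurs.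
𝓦? : ∀ n → Decidable (𝓦 n)
𝓦? n w = (length w ≟ n) ×-dec
  map′ (λ { (h , h< , below , above) → h , s≤s⁻¹ h< ,
              λ k → mk⇔ (All.lookup below) (λ k≤h → All.lookup above (∈-upTo⁺ (s≤s k≤h))) })
       (λ { (h , h≤ , letters) → h , s≤s h≤ ,
              All.tabulate (λ {k} → to (letters k)) ,
              All.tabulate (λ {k} k∈ → from (letters k) (s≤s⁻¹ (∈-upTo⁻ k∈))) })
       -- The search bound is strict, hence `suc (n ∸ 1)` for `h ≤ n ∸ 1`.
       (anyUpTo? (λ h → All.all? (_≤? h) w ×-dec All.all? (_∈? w) (upTo (suc h))) (suc (n ∸ 1)))

words : ℕ → ℕ → List (List ℕ)
words m zero    = [ [] ]
words m (suc l) = cartesianProductWith _∷_ (upTo m) (words m l)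

∈-words : ∀ {m} w → All (_< m) w → w ∈ words m (length w)
∈-words []      []         = here refl
∈-words (x ∷ w) (x< ∷ w<) = ∈-cartesianProductWith⁺ _∷_ (∈-upTo⁺ x<) (∈-words w w<)

-- Letters are at most `n ∸ 1`, which is below `n` for positive `n`; so `words n n` is a finite list
-- through which `exhaust` can run.
𝓦⇒∈-words : ∀ {n w} → 1 ≤ n → 𝓦 n w → w ∈ words n n
𝓦⇒∈-words {suc n} {w} _ (len , h , h≤ , letters) =
  subst (λ l → w ∈ words (suc n) l) len
    (∈-words w (All.tabulate (λ {k} k∈ → s≤s (≤-trans (to (letters k) k∈) h≤))))

all-zero : (w : List ℕ) → All (_≡ 0) w → w ≡ replicate (length w) 0
all-zero []      []         = refl
all-zero (x ∷ w) (refl ∷ w≡) = cong (0 ∷_) (all-zero w w≡)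

𝓦-zeros : ∀ {n} → 1 ≤ n → 𝓦 n (replicate n 0)
𝓦-zeros {suc n} _ = length-replicate (suc n) , 0 , z≤n , λ k → mk⇔
  (λ k∈ → ≤-reflexive (All.lookup (replicate⁺ {P = _≡ 0} (suc n) refl) k∈))
  (λ { z≤n → here refl })

rotate-zeros : ∀ k n → rotate k (replicate n 0) ≡ replicate n 0
rotate-zeros k n = begin
  rotate k zeros                        ≡⟨ all-zero _ (All-resp-↭ (↭-sym perm) (replicate⁺ n refl)) ⟩
  replicate (length (rotate k zeros)) 0 ≡⟨ cong (λ l → replicate l 0) (trans (↭-length perm) (length-replicate n)) ⟩
  zeros                                 ∎
  where
  open ≡-Reasoning
  zeros = replicate n 0
  perm = rotate-↭ k zeros

-- If the largest letter occurs again in `t`, the height stays `suc g`; otherwise it drops to `g`,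
-- and all letters up to `g` survive in `t`. Having the letter at the head is no restriction, since
-- `𝓦 n` is invariant under permutation.
𝓦-lower-max : ∀ {n g t} → length (suc g ∷ t) ≡ n → suc g ≤ n ∸ 1 →
              (∀ k → k ∈ suc g ∷ t ⇔ k ≤ suc g) → 𝓦 n (0 ∷ t)
𝓦-lower-max {n} {g} {t} len h≤ letters with suc g ∈? t
... | yes h∈t = len , suc g , h≤ , λ k → mk⇔
  (λ { (here refl) → z≤n ; (there k∈) → to (letters k) (there k∈) })
  (λ k≤ → there (in-tail (from (letters k) k≤)))
  where
  in-tail : ∀ {k} → k ∈ suc g ∷ t → k ∈ t
  in-tail (here refl) = h∈t
  in-tail (there k∈)  = k∈
... | no  h∉t = len , g , <⇒≤ h≤ , λ k → mk⇔
  (λ { (here refl) → z≤n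
     ; (there k∈)  → s≤s⁻¹ (≤∧≢⇒< (to (letters k) (there k∈)) (λ { refl → h∉t k∈ })) })
  (λ k≤g → there (in-tail k≤g (from (letters k) (m≤n⇒m≤1+n k≤g))))
  where
  in-tail : ∀ {k} → k ≤ g → k ∈ suc g ∷ t → k ∈ t
  in-tail k≤g (here refl) = contradiction k≤g 1+n≰n
  in-tail _   (there k∈)  = k∈

-- Overlap cycles by descent to the zero word

overlap-rotate : ∀ {s} (w : List A) → s ≤ length w → Overlap s (rotate s w) w
overlap-rotate {s = s} w s≤ = subst (λ v → Overlap s (rotate s v) v) (take++drop≡id s w)
  -- Since `s ≤ length w`, `s` can be replaced by `length p`, the form in which `rotate-++` applies.
  (subst (λ k → Overlap k (rotate k (p ++ q)) (p ++ q))
    (trans (length-take s w) (m≤n⇒m⊓n≡m s≤)) split)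
  where
  p = take s w
  q = drop s w
  split : Overlap (length p) (rotate (length p) (p ++ q)) (p ++ q)
  split rewrite rotate-++ p q | length-++ q {p} | m+n∸n≡m (length q) (length p) =
    trans (drop-length-++ q p) (sym (take-length-++ p q))

module _ {n s : ℕ} (1≤n : 1 ≤ n) (s<n : s < n) where

  open Splicing (≡-dec _≟_) (𝓦 n) (Overlap s) (rotate s) (rotate-injective s) (rotate-periodic s)
    (λ {w} → 𝓦-resp-↭ (↭-sym (rotate-↭ s w)))
    (λ {w} (len , _) → overlap-rotate w (subst (s ≤_) (sym len) (<⇒≤ s<n)))
    (replicate n 0)

  reach : ∀ {w} → Acc _<_ (sum w) → 𝓦 n w → Reachable w
  reach {w} _ (len , zero , _ , letters) =
    subst Reachable (sym (trans (all-zero w zero-letters) (cong (λ l → replicate l 0) len))) reach-root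
    where
    zero-letters : All (_≡ 0) w
    zero-letters = All.tabulate (λ {k} k∈ → n≤0⇒n≡0 (to (letters k) k∈))
  reach (acc rec) W@(len , suc g , h≤ , letters)
    with p , q , refl ← ∈-∃++ (from (letters (suc g)) ≤-refl) =
    rotate-past-prefix Reachable s<n reach-τ (suc g) p q len λ p′ q′ perm s≤ →
      let
        front : suc g ∷ p′ ++ q′ ↭ p ++ suc g ∷ q
        front = ↭-trans (↭-sym (shift (suc g) p′ q′)) perm
        -- As `s ≤ length p′`, the altered letter lies outside the `s`-prefix.
        same : ∀ x y → take s (p′ ++ x ∷ q′) ≡ take s (p′ ++ y ∷ q′)
        same x y = take-++-≤ s p′ (x ∷ q′) (y ∷ q′) s≤
        decrease : sum (p′ ++ 0 ∷ q′) < sum (p ++ suc g ∷ q)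
        decrease = begin-strict
          sum (p′ ++ 0 ∷ q′)            ≡⟨ sum-↭ (shift 0 p′ q′) ⟩
          sum (p′ ++ q′)                <⟨ s≤s (m≤n+m (sum (p′ ++ q′)) g) ⟩
          suc g + sum (p′ ++ q′)        ≡⟨ sum-↭ front ⟩
          sum (p ++ suc g ∷ q)          ∎
        lowered : 𝓦 n (p′ ++ 0 ∷ q′)
        lowered = 𝓦-resp-↭ (↭-sym (shift 0 p′ q′))
          (𝓦-lower-max (trans (↭-length front) len) h≤ λ k →
            mk⇔ (to (letters k) ∘ ∈-resp-↭ front) (∈-resp-↭ (↭-sym front) ∘ from (letters k)))
      in reach-twin (𝓦-resp-↭ (↭-sym perm) W)
           -- `Overlap s z v` depends on `v` only through `take s v`, so both words have the same
           -- predecessors.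
           (λ o → trans o (same (suc g) 0)) (λ o → trans o (same 0 (suc g)))
           (reach (rec decrease) lowered)
    where open ≤-Reasoning

  overlapCycle : ∃[ ws ] IsOverlapCycle s (𝓦 n) ws
  overlapCycle
    with ws , C , _ , complete ← exhaust (𝓦? n) (reach (<-wellFounded _)) (words n n)
           -- The zero word is fixed by rotation, so it alone forms the initial partial cycle.
           (singleton (𝓦-zeros 1≤n) (rotate-zeros s n))
    = ws , record
      { unique = unique
      ; lists  = λ w → mk⇔ (All.lookup sound) (λ W → complete (W , 𝓦⇒∈-words 1≤n W))
      ; cyclic = cyclic
      }
    where open PartialCycle C

theorem4p1 : (n : ℕ) → 1 ≤ n → (s : ℕ) → 1 ≤ s → s ≤ n ∸ 1 →
    ∃[ ws ] IsOverlapCycle s (𝓦 n) ws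
theorem4p1 (suc n) 1≤n s _ s≤n = overlapCycle 1≤n (s≤s s≤n)
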